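{- Let $(u_1, u_2, u_3, u_4)$ be a Büchi quadruple. Then there exist non-negative integers $s_0, s_1, \dots, s_{15}$, $\beta_1, \beta_2 \in \{1,2\}$, and $\delta \in \{1,3\}$ satisfying the relations \[ s_8 = \frac{(3/\delta) s_4 s_{11} - s_1 s_{14}}{\beta_1 (2/\beta_2) s_7}, \qquad s_{13} = \frac{s_4 s_{11} + \delta s_1 s_{14}}{\beta_1 (2/\beta_2) s_2},\] \[ s_3 = \frac{(s_1 s_{14} + (3/\delta) s_4 s_{11}) s_9 - 2 s_4 s_{14} s_{12}}{2 s_2 s_7}, \qquad s_6 = \frac{2 s_1 s_{11} s_9 - (\delta s_1 s_{14} - s_4 s_{11}) s_{12}}{2 s_2 s_7},\] \[ s_0 = \frac{s_9 s_{11} - \delta s_{12} s_{14}}{\beta_1 s_2}, \qquad s_5 = \frac{(3/\delta) s_9 s_{11} - s_{12} s_{14}}{\beta_1 s_7},\] \[ s_{10} = \frac{s_1 s_9 + s_4 s_{12}}{\beta_1 s_2}, \qquad s_{15} = \frac{ -s_1 s_9 + s_4 s_{12}}{\beta_1 s_7},\] such that, with \[ x_1 = s_0 s_2 s_4 s_6 s_8 s_{10} s_{12} s_{14}, \quad y_1 = s_1 s_3 s_5 s_7 s_9 s_{11} s_{13} s_{15},\] \[ x_2 = s_0 s_1 s_4 s_5 s_8 s_9 s_{12} s_{13}, \quad y_2 = s_2 s_3 s_6 s_7 s_{10} s_{11} s_{14} s_{15},\] \[ x_3 = s_0 s_1 s_2 s_3 s_8 s_9 s_{10} s_{11}, \quad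 y_3 = s_4 s_5 s_6 s_7 s_{12} s_{13} s_{14} s_{15},\] \[ x_4 = s_0 s_1 s_2 s_3 s_4 s_5 s_6 s_7, \quad y_4 = s_8 s_9 s_{10} s_{11} s_{12} s_{13} s_{14} s_{15},\] one has $u_k = x_k - y_k$ for $k = 1,2,3,4$.
   Context: A Büchi $n$-tuple is an $n$-tuple $(u_1, \dots, u_n)$ of positive integers such that $u_1^2, \dots, u_n^2$ is an increasing sequence of squares with second difference equal to $2$, i.e. $u_{k+2}^2 - 2u_{k+1}^2 + u_k^2 = 2$ for $1 \le k \le n-2$. A Büchi quadruple is a Büchi $4$-tuple. -}

module Defs where

open import Data.Nat.Base using (ℕ; suc; NonZero; _+_; _*_; _^_; _/_; _<_)
open import Data.Integer.Base as ℤ using (ℤ; +_; _-_)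
import Data.Rational.Base as ℚ
open import Data.Fin as Fin using (Fin; toℕ; #_)
open import Data.Vec.Functional using (Vector; []; _∷_)
open import Relation.Binary.PropositionalEquality.Core using (_≡_)

-- The entry u_k of a tuple is the value at the index k - 1 of Fin n.
record IsBüchi {n : ℕ} (u : Vector ℕ n) : Set where
  field
    positive         : ∀ k → 0 < u k
    increasing       : ∀ {i j} → i Fin.< j → u i ^ 2 < u j ^ 2
    secondDifference : ∀ {i j k} → toℕ j ≡ suc (toℕ i) → toℕ k ≡ suc (toℕ j) →
                       + (u k ^ 2) - + (2 * u j ^ 2) ℤ.+ + (u i ^ 2) ≡ + 2

-- q ≐ a ∕ b  is an equality of rational numbers, and includes the assertion
-- that the denominator b does not vanish.
infix 4 _≐_∕_
record _≐_∕_ (q : ℕ) (a : ℤ) (b : ℕ) : Set where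
  field
    {{nonZero}} : NonZero b
    equality    : (+ q) ℚ./ 1 ≡ a ℚ./ b

module _ (s : Vector ℕ 16) where

  s₀ s₁ s₂ s₃ s₄ s₅ s₆ s₇ s₈ s₉ s₁₀ s₁₁ s₁₂ s₁₃ s₁₄ s₁₅ : ℕ
  s₀  = s (# 0)
  s₁  = s (# 1)
  s₂  = s (# 2)
  s₃  = s (# 3)
  s₄  = s (# 4)
  s₅  = s (# 5)
  s₆  = s (# 6)
  s₇  = s (# 7)
  s₈  = s (# 8)
  s₉  = s (# 9)
  s₁₀ = s (# 10)
  s₁₁ = s (# 11)
  s₁₂ = s (# 12)
  s₁₃ = s (# 13)
  s₁₄ = s (# 14)
  s₁₅ = s (# 15)

  -- The natural-number quotients 3 / δ and 2 / β₂ are exact for δ ∈ {1, 3} and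
  -- β₂ ∈ {1, 2}, the only values for which the relations are used.
  record Relations (β₁ β₂ δ : ℕ) : Set where
    field
      {{β₂-nonZero}} : NonZero β₂
      {{δ-nonZero}}  : NonZero δ
      eq₈  : s₈ ≐ + ((3 / δ) * s₄ * s₁₁) - + (s₁ * s₁₄)
                  ∕ β₁ * (2 / β₂) * s₇
      eq₁₃ : s₁₃ ≐ + (s₄ * s₁₁ + δ * s₁ * s₁₄)
                   ∕ β₁ * (2 / β₂) * s₂
      eq₃  : s₃ ≐ + ((s₁ * s₁₄ + (3 / δ) * s₄ * s₁₁) * s₉) - + (2 * s₄ * s₁₄ * s₁₂)
                  ∕ 2 * s₂ * s₇
      eq₆  : s₆ ≐ + (2 * s₁ * s₁₁ * s₉) - (+ (δ * s₁ * s₁₄) - + (s₄ * s₁₁)) ℤ.* + s₁₂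
                  ∕ 2 * s₂ * s₇
      eq₀  : s₀ ≐ + (s₉ * s₁₁) - + (δ * s₁₂ * s₁₄)
                  ∕ β₁ * s₂
      eq₅  : s₅ ≐ + ((3 / δ) * s₉ * s₁₁) - + (s₁₂ * s₁₄)
                  ∕ β₁ * s₇
      eq₁₀ : s₁₀ ≐ + (s₁ * s₉ + s₄ * s₁₂)
                   ∕ β₁ * s₂
      eq₁₅ : s₁₅ ≐ ℤ.- (+ (s₁ * s₉)) ℤ.+ + (s₄ * s₁₂)
                   ∕ β₁ * s₇

  x y : Vector ℕ 4
  x = s₀ * s₂ * s₄ * s₆ * s₈ * s₁₀ * s₁₂ * s₁₄
    ∷ s₀ * s₁ * s₄ * s₅ * s₈ * s₉ * s₁₂ * s₁₃
    ∷ s₀ * s₁ * s₂ * s₃ * s₈ * s₉ * s₁₀ * s₁₁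
    ∷ s₀ * s₁ * s₂ * s₃ * s₄ * s₅ * s₆ * s₇
    ∷ []
  y = s₁ * s₃ * s₅ * s₇ * s₉ * s₁₁ * s₁₃ * s₁₅
    ∷ s₂ * s₃ * s₆ * s₇ * s₁₀ * s₁₁ * s₁₄ * s₁₅
    ∷ s₄ * s₅ * s₆ * s₇ * s₁₂ * s₁₃ * s₁₄ * s₁₅
    ∷ s₈ * s₉ * s₁₀ * s₁₁ * s₁₂ * s₁₃ * s₁₄ * s₁₅
    ∷ []

{-# OPTIONS --safe #-}
module Submission where

-- The differences u_{k+1}² − u_k² are odd and grow by 2, so that there are w
-- and N with u_k² + 4 N = (w + k − 1)² for all k. Hence u_k = x_k − y_k with
-- x_k y_k = N and x_k + y_k = w + k − 1. If N = 0, all y_k vanish and the s_n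
-- can be written down. Otherwise a common refinement of the four
-- factorisations N = x_k y_k yields s₀, …, s₁₅, where the k-th lowest binary
-- digit of n tells whether s_n divides x_k (digit 0) or y_k (digit 1).
--
-- For i < j, the four factors in x_i = a b, y_i = c d, x_j = a c, y_j = b d
-- satisfy (a − d) (c − b) = (x_j + y_j) − (x_i + y_i) = j − i. Below, Eᵢⱼ and
-- Fᵢⱼ are the equations giving the values e and f of a − d and c − b. With
-- β₁ = f₁₃, β₂ = f₂₄ and δ = e₁₄ the asserted relations are consequences of
-- these twelve equations, but those for s₃ and s₆ only if f₁₃ e₂₄ = 2, that
-- is if β₁ = β₂. The refinement therefore has to be chosen accordingly.

open import Defs
open import Data.Fin.Base as Fin using (toℕ)
open import Data.Fin using (#_)
open import Data.Integer.Base as ℤ using (+_; _-_)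
import Data.Integer.Properties as ℤ
import Data.Integer.Tactic.RingSolver as ℤ-Solver
open import Data.List.Base using (_∷_; [])
open import Data.List.Membership.Propositional using (_∈_)
open import Data.List.Relation.Unary.Any using (here; there)
open import Data.Nat.Base
open import Data.Nat.Coprimality as Coprime using (Coprime; coprime-divisor; coprime-/gcd)
open import Data.Nat.Divisibility
open import Data.Nat.DivMod using (m*[n/m]≡n)
open import Data.Nat.GCD using (gcd; gcd[m,n]∣m; gcd[m,n]∣n; gcd[m,n]≢0)
open import Data.Nat.Primality
  using (Prime; prime?; prime[2]; prime⇒irreducible; prime⇒nonZero; euclidsLemma)
open import Data.Nat.Properties
open import Data.Nat.Tactic.RingSolver using (solve; solve-∀)
open import Data.Product.Base
open import Data.Rational.Unnormalised.Base using (mkℚᵘ; *≡*)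
import Data.Rational.Properties as ℚ
open import Data.Sum.Base using (_⊎_; inj₁; inj₂)
open import Data.Vec.Base as Vec using (Vec; zipWith; foldr₁; foldr′)
open import Data.Vec.Functional as Vector using (Vector)
open import Relation.Binary.PropositionalEquality
open import Relation.Nullary.Decidable using (toWitness)
open import Relation.Nullary.Negation using (contradiction)

-- Common refinement of two factorisations

*-swapˡ : ∀ m n o → m * (n * o) ≡ n * (m * o)
*-swapˡ = solve-∀

opaque
  coprime-cofactor : ∀ {b c y Y} → Coprime c b → NonZero c → b * y ≡ c * Y →
    ∃ λ d → y ≡ c * d × Y ≡ b * d
  coprime-cofactor {b} {c} {y} {Y} coprime c≢0 by≡cY
    with divides d y≡dc ← coprime-divisor coprime (subst (c ∣_) (sym by≡cY) (m∣m*n Y))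
    = d , y≡cd , *-cancelˡ-≡ Y (b * d) c {{c≢0}} (begin
      c * Y        ≡⟨ by≡cY ⟨
      b * y        ≡⟨ cong (b *_) y≡cd ⟩
      b * (c * d)  ≡⟨ *-swapˡ b c d ⟩
      c * (b * d)  ∎)
    where
    open ≡-Reasoning
    y≡cd : y ≡ c * d
    y≡cd = trans y≡dc (*-comm d c)

opaque
  -- Take `a` to be the gcd of `x` and `X`. The cofactors `b` and `c` are then coprime, and
  -- cancelling `a` leaves `b * y ≡ c * Y`, so that `c` divides `y`.
  four-number : ∀ x y X Y → NonZero (x * y) → x * y ≡ X * Y →
    ∃₂ λ a b → ∃₂ λ c d → x ≡ a * b × y ≡ c * d × X ≡ a * c × Y ≡ b * d
  four-number x y X Y xy≢0 xy≡XY =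
    factors (gcd x X) gcd≢0 _ _
      (sym (m*[n/m]≡n {{gcd≢0}} (gcd[m,n]∣m x X)))
      (sym (m*[n/m]≡n {{gcd≢0}} (gcd[m,n]∣n x X)))
      (Coprime.sym (coprime-/gcd x X {{gcd≢0}}))
    where
    open ≡-Reasoning
    X≢0 : NonZero X
    X≢0 = m*n≢0⇒m≢0 X {{subst NonZero xy≡XY xy≢0}}
    gcd≢0 : NonZero (gcd x X)
    gcd≢0 = ≢-nonZero (gcd[m,n]≢0 x X (inj₂ (≢-nonZero⁻¹ X {{X≢0}})))
    factors : ∀ a → NonZero a → ∀ b c → x ≡ a * b → X ≡ a * c → Coprime c b →
      ∃₂ λ a b → ∃₂ λ c d → x ≡ a * b × y ≡ c * d × X ≡ a * c × Y ≡ b * d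
    factors a a≢0 b c x≡ab X≡ac coprime
      with d , y≡cd , Y≡bd ← coprime-cofactor coprime (m*n≢0⇒n≢0 a {{subst NonZero X≡ac X≢0}})
             (*-cancelˡ-≡ (b * y) (c * Y) a {{a≢0}} (begin
               a * (b * y) ≡⟨ *-assoc a b y ⟨
               a * b * y   ≡⟨ cong (_* y) x≡ab ⟨
               x * y       ≡⟨ xy≡XY ⟩
               X * Y       ≡⟨ cong (_* Y) X≡ac ⟩
               a * c * Y   ≡⟨ *-assoc a c Y ⟩
               a * (c * Y) ∎))
      = a , b , c , d , x≡ab , y≡cd , X≡ac , Y≡bd

product : ∀ {n} → Vec ℕ n → ℕ
product = foldr′ _*_ 1

-- By induction on `v`: `four-number` distributes the head `c` between `x` and `y` as `a * a′`, and
-- the remaining parts `b` and `b′` factor the product of the tail.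
split-product : ∀ {n} (v : Vec ℕ n) x y → NonZero (product v) → x * y ≡ product v →
  ∃₂ λ p q → v ≡ zipWith _*_ p q × x ≡ product p × y ≡ product q
split-product Vec.[] x y _ xy≡1 = Vec.[] , Vec.[] , refl , m*n≡1⇒m≡1 x y xy≡1 , m*n≡1⇒n≡1 x y xy≡1
split-product (c Vec.∷ v) x y cv≢0 xy≡cv
  with a , b , a′ , b′ , x≡ab , y≡a′b′ , c≡aa′ , v≡bb′ ←
         four-number x y c (product v) (subst NonZero (sym xy≡cv) cv≢0) xy≡cv
  with p , q , v≡pq , b≡p , b′≡q ← split-product v b b′ (m*n≢0⇒n≢0 c {{cv≢0}}) (sym v≡bb′)
  = a Vec.∷ p , a′ Vec.∷ q , cong₂ Vec._∷_ c≡aa′ v≡pq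
  , trans x≡ab (cong (a *_) b≡p) , trans y≡a′b′ (cong (a′ *_) b′≡q)

-- From a Büchi quadruple to factorisations of one number N

even-or-odd : ∀ n → (∃ λ m → n ≡ 2 * m) ⊎ (∃ λ m → n ≡ suc (2 * m))
even-or-odd zero    = inj₁ (0 , refl)
even-or-odd (suc n) with even-or-odd n
... | inj₁ (m , refl) = inj₂ (m , refl)
... | inj₂ (m , refl) = inj₁ (suc m , sym (*-suc 2 m))

square-cancel-≤ : ∀ {m n} → m * m ≤ n * n → m ≤ n
square-cancel-≤ m²≤n² = ≮⇒≥ λ n<m → <⇒≱ (*-mono-< n<m n<m) m²≤n²

^2≡* : ∀ n → n ^ 2 ≡ n * n
^2≡* n = cong (n *_) (*-identityʳ n)

second-difference : ∀ a b c → + (c ^ 2) - + (2 * b ^ 2) ℤ.+ + (a ^ 2) ≡ + 2 →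
  c * c + a * a ≡ 2 * (b * b) + 2
second-difference a b c h = begin
  c * c + a * a    ≡⟨ cong₂ _+_ (^2≡* c) (^2≡* a) ⟨
  c ^ 2 + a ^ 2    ≡⟨ ℤ.+-injective (trans (regroup (+ (c ^ 2)) (+ (2 * b ^ 2)) (+ (a ^ 2)))
                        (cong (λ t → + (2 * b ^ 2) ℤ.+ t) h)) ⟩
  2 * b ^ 2 + 2    ≡⟨ cong (λ t → 2 * t + 2) (^2≡* b) ⟩
  2 * (b * b) + 2  ∎
  where
  open ≡-Reasoning
  regroup : ∀ c b a → c ℤ.+ a ≡ b ℤ.+ (c - b ℤ.+ a)
  regroup = ℤ-Solver.solve-∀

opaque
  square-+ : ∀ u t → (u + t) * (u + t) ≡ u * u + (t * t + 2 * u * t)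
  square-+ = solve-∀

  even-gap : ∀ u r → 2 * (2 * ((u + r) * r)) ≡ 2 * r * (2 * r) + 2 * u * (2 * r)
  even-gap = solve-∀

  odd-gap : ∀ u r → 1 + 2 * (2 * r * (r + 1) + u * (1 + 2 * r)) ≡
                    (1 + 2 * r) * (1 + 2 * r) + 2 * u * (1 + 2 * r)
  odd-gap = solve-∀

  same-parity-gap : ∀ a h → 2 * ((a + 2 * h) * (a + 2 * h)) + 2 ≡
                            a * a + 2 * (1 + 2 * (2 * (h * (a + h)))) + a * a
  same-parity-gap = solve-∀

-- Write `w` as `u + t`. Then t² + 2ut is twice `k`, hence t² is even and so is `t`.
square-difference : ∀ {u w k} → w * w ≡ u * u + 2 * k →
  ∃ λ r → w ≡ u + 2 * r × 2 * ((u + r) * r) ≡ k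
square-difference {u} {w} {k} w²≡u²+2k
  with t , refl ← m≤n⇒∃[o]m+o≡n
         (square-cancel-≤ {u} {w} (subst (u * u ≤_) (sym w²≡u²+2k) (m≤m+n (u * u) (2 * k))))
  with +-cancelˡ-≡ (u * u) _ _ (trans (sym (square-+ u t)) w²≡u²+2k) | even-or-odd t
... | gap | inj₁ (r , refl) = r , refl , *-cancelˡ-≡ _ _ 2 (trans (even-gap u r) gap)
... | gap | inj₂ (r , refl) = contradiction (sym (trans (odd-gap u r) gap))
      (even≢odd k (2 * r * (r + 1) + u * (1 + 2 * r)))

-- If a and b had the same parity, then c² − a² would be 2 modulo 4.
successor-offset : ∀ {a b c} → a ≤ b → c * c + a * a ≡ 2 * (b * b) + 2 →
  ∃ λ h → b ≡ a + (1 + 2 * h)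
successor-offset {a} {b} {c} a≤b second
  with t , refl ← m≤n⇒∃[o]m+o≡n a≤b
  with even-or-odd t
... | inj₂ (h , refl) = h , refl
... | inj₁ (h , refl)
  with r , _ , 2[a+r]r≡odd ← square-difference {a} {c} {1 + 2 * (2 * (h * (a + h)))}
         (+-cancelʳ-≡ (a * a) _ _ (trans second (same-parity-gap a h)))
  = contradiction 2[a+r]r≡odd (even≢odd ((a + r) * r) (2 * (h * (a + h))))

-- The squares of consecutive integers also have second difference 2. Two such sequences that differ
-- by `M` at two consecutive places therefore differ by `M` at the next one.
next-square : ∀ w i {a b c M} →
  (w + i) * (w + i) ≡ a * a + M → (w + (1 + i)) * (w + (1 + i)) ≡ b * b + M →
  c * c + a * a ≡ 2 * (b * b) + 2 → (w + (2 + i)) * (w + (2 + i)) ≡ c * c + M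
next-square w i {a} {b} {c} {M} A B second = +-cancelʳ-≡ ((w + i) * (w + i)) _ _ (begin
  (w + (2 + i)) * (w + (2 + i)) + (w + i) * (w + i)  ≡⟨ squares w i ⟩
  2 * ((w + (1 + i)) * (w + (1 + i))) + 2            ≡⟨ cong (λ t → 2 * t + 2) B ⟩
  2 * (b * b + M) + 2                                ≡⟨ regroup (b * b) M ⟩
  2 * (b * b) + 2 + 2 * M                            ≡⟨ cong (_+ 2 * M) second ⟨
  c * c + a * a + 2 * M                              ≡⟨ regroup′ (a * a) (c * c) M ⟩
  c * c + M + (a * a + M)                            ≡⟨ cong (λ t → c * c + M + t) A ⟨
  c * c + M + (w + i) * (w + i)                      ∎)
  where
  open ≡-Reasoning
  squares : ∀ w i → (w + (2 + i)) * (w + (2 + i)) + (w + i) * (w + i) ≡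
                    2 * ((w + (1 + i)) * (w + (1 + i))) + 2
  squares = solve-∀
  regroup : ∀ b M → 2 * (b + M) + 2 ≡ 2 * b + 2 + 2 * M
  regroup = solve-∀
  regroup′ : ∀ a c M → c + a + 2 * M ≡ c + M + (a + M)
  regroup′ = solve-∀

2∣n*[1+n] : ∀ n → 2 ∣ n * (1 + n)
2∣n*[1+n] n with even-or-odd n
... | inj₁ (m , refl) = ∣m⇒∣m*n (1 + 2 * m) (m∣m*n m)
... | inj₂ (m , refl) = ∣n⇒∣m*n (1 + 2 * m) (subst (2 ∣_) (*-suc 2 m) (m∣m*n (1 + m)))

-- If u₂ = u₁ + 1 + 2 h, then w and N are determined by 2 w + 1 = u₂² − u₁² and
-- 4 N = w² − u₁².
common-product : ∀ {u : Vector ℕ 4} → IsBüchi u →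
  ∃₂ λ w N → 2 ∣ N × (∀ k → ∃ λ v → w + toℕ k ≡ u k + 2 * v × (u k + v) * v ≡ N)
common-product {u} büchi =
  let h , b≡a+[1+2h] = successor-offset {a} {b} {c} a≤b c²+a²≡2b²+2
  in w h , N h , ∣m⇒∣m*n _ (2∣n*[1+n] h) , λ k → halve {u k} (square h b≡a+[1+2h] k)
  where
  open IsBüchi büchi
  a b c d : ℕ
  a = u (# 0)
  b = u (# 1)
  c = u (# 2)
  d = u (# 3)
  a≤b : a ≤ b
  a≤b = square-cancel-≤ (<⇒≤ (subst₂ _<_ (^2≡* a) (^2≡* b) (increasing (s≤s z≤n))))
  c²+a²≡2b²+2 : c * c + a * a ≡ 2 * (b * b) + 2
  c²+a²≡2b²+2 = second-difference a b c (secondDifference {# 0} {# 1} {# 2} refl refl)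
  d²+b²≡2c²+2 : d * d + b * b ≡ 2 * (c * c) + 2
  d²+b²≡2c²+2 = second-difference b c d (secondDifference {# 1} {# 2} {# 3} refl refl)
  w N : ℕ → ℕ
  w h = a + 2 * (h * (1 + (a + h)))
  -- Here w - a = 2h(1 + a + h) and w + a = 2(1 + h)(a + h). Arranging the four factors in this
  -- order exhibits the product h(1 + h) of consecutive integers, which makes N even.
  N h = h * (1 + h) * ((a + h) * (1 + (a + h)))
  square₀ : ∀ a h → (a + 2 * (h * (1 + (a + h))) + 0) * (a + 2 * (h * (1 + (a + h))) + 0) ≡
                    a * a + 2 * (2 * (h * (1 + h) * ((a + h) * (1 + (a + h)))))
  square₀ = solve-∀
  square₁ : ∀ a h → (a + 2 * (h * (1 + (a + h))) + 1) * (a + 2 * (h * (1 + (a + h))) + 1) ≡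
                    (a + (1 + 2 * h)) * (a + (1 + 2 * h)) + 2 * (2 * (h * (1 + h) * ((a + h) * (1 + (a + h)))))
  square₁ = solve-∀
  square : ∀ h → b ≡ a + (1 + 2 * h) → ∀ k → (w h + toℕ k) * (w h + toℕ k) ≡ u k * u k + 2 * (2 * N h)
  square h b≡a+[1+2h] = λ where
      Fin.zero                               → S₀
      (Fin.suc Fin.zero)                     → S₁
      (Fin.suc (Fin.suc Fin.zero))           → S₂
      (Fin.suc (Fin.suc (Fin.suc Fin.zero))) → next-square (w h) 1 {b} {c} {d} S₁ S₂ d²+b²≡2c²+2
    where
    S₀ : (w h + 0) * (w h + 0) ≡ a * a + 2 * (2 * N h)
    S₀ = square₀ a h
    S₁ : (w h + 1) * (w h + 1) ≡ b * b + 2 * (2 * N h)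
    S₁ = trans (square₁ a h) (cong (λ t → t * t + 2 * (2 * N h)) (sym b≡a+[1+2h]))
    S₂ : (w h + 2) * (w h + 2) ≡ c * c + 2 * (2 * N h)
    S₂ = next-square (w h) 0 {a} {b} {c} S₀ S₁ c²+a²≡2b²+2
  halve : ∀ {u w N} → w * w ≡ u * u + 2 * (2 * N) → ∃ λ v → w ≡ u + 2 * v × (u + v) * v ≡ N
  halve {u} {w} w²≡u²+4N =
    let v , w≡u+2v , 2[u+v]v≡2N = square-difference {u} {w} w²≡u²+4N
    in v , w≡u+2v , *-cancelˡ-≡ _ _ 2 2[u+v]v≡2N

-- Pairs of factorisations and their differences

prime-factors : ∀ {p m n} → Prime p → m * n ≡ p → (m ≡ 1 × n ≡ p) ⊎ (m ≡ p × n ≡ 1)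
prime-factors {p} {m} {n} pr mn≡p with prime⇒irreducible pr (divides n (trans (sym mn≡p) (*-comm m n)))
... | inj₁ m≡1 = inj₁ (m≡1 , trans (sym (*-identityˡ n)) (trans (cong (_* n) (sym m≡1)) mn≡p))
... | inj₂ m≡p = inj₂ (m≡p , *-cancelˡ-≡ n 1 p {{prime⇒nonZero pr}}
                         (trans (trans (cong (_* n) (sym m≡p)) mn≡p) (sym (*-identityʳ p))))

-- Since xX = a²bc and yY = d²bc, the inequalities y < x and Y < X force d < a. With a = d + e the
-- hypothesis on the sums becomes ec = eb + t, whence b ≤ c and e(c - b) = t.
differences : ∀ {x y X Y} a b c d {t} → x ≡ a * b → y ≡ c * d → X ≡ a * c → Y ≡ b * d →
  y < x → Y < X → X + Y ≡ x + y + t →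
  ∃₂ λ e f → a ≡ d + e × c ≡ b + f × e * f ≡ t
differences a b c d {t} refl refl refl refl y<x Y<X sum = e , f , a≡d+e , c≡b+f , ef≡t
  where
  d<a : d < a
  d<a = ≰⇒> λ a≤d → <⇒≱ (*-mono-< y<x Y<X) (begin
    a * b * (a * c) ≡⟨ solve (a ∷ b ∷ c ∷ []) ⟩
    a * a * (b * c) ≤⟨ *-monoˡ-≤ (b * c) (*-mono-≤ a≤d a≤d) ⟩
    d * d * (b * c) ≡⟨ solve (b ∷ c ∷ d ∷ []) ⟩
    c * d * (b * d) ∎)
    where open ≤-Reasoning
  e = a ∸ d
  a≡d+e : a ≡ d + e
  a≡d+e = sym (m+[n∸m]≡n (<⇒≤ d<a))
  e≢0 : NonZero e
  e≢0 = >-nonZero (m<n⇒0<n∸m d<a)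
  open ≡-Reasoning
  ec≡eb+t : e * c ≡ e * b + t
  ec≡eb+t = +-cancelˡ-≡ (d * c + b * d) _ _ (begin
    d * c + b * d + e * c        ≡⟨ regroup d e c (b * d) ⟩
    (d + e) * c + b * d          ≡⟨ cong (λ z → z * c + b * d) a≡d+e ⟨
    a * c + b * d                ≡⟨ sum ⟩
    a * b + c * d + t            ≡⟨ cong (λ z → z * b + c * d + t) a≡d+e ⟩
    (d + e) * b + c * d + t      ≡⟨ regroup′ d e b c t ⟩
    d * c + b * d + (e * b + t)  ∎)
    where
    regroup : ∀ d e c n → d * c + n + e * c ≡ (d + e) * c + n
    regroup = solve-∀
    regroup′ : ∀ d e b c t → (d + e) * b + c * d + t ≡ d * c + b * d + (e * b + t)
    regroup′ = solve-∀
  f = c ∸ b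
  c≡b+f : c ≡ b + f
  c≡b+f = sym (m+[n∸m]≡n (*-cancelˡ-≤ e {{e≢0}}
            (subst (e * b ≤_) (sym ec≡eb+t) (m≤m+n (e * b) t))))
  ef≡t : e * f ≡ t
  ef≡t = +-cancelˡ-≡ (e * b) _ _ (begin
    e * b + e * f  ≡⟨ *-distribˡ-+ e b f ⟨
    e * (b + f)    ≡⟨ cong (e *_) c≡b+f ⟨
    e * c          ≡⟨ ec≡eb+t ⟩
    e * b + t      ∎)

-- A 2 × 2 table with rows a, b and c, d: the row products are `x` and `y`, the column products `X`
-- and `Y`, while `e` and `f` are the differences along the two diagonals.
record Grid (x y X Y e f : ℕ) : Set where
  field
    {a b c d} : ℕ
    x≡ab  : x ≡ a * b
    y≡cd  : y ≡ c * d
    X≡ac  : X ≡ a * c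
    Y≡bd  : Y ≡ b * d
    a≡d+e : a ≡ d + e
    c≡b+f : c ≡ b + f

opaque
  grid : ∀ {x y X Y t} → NonZero (x * y) → x * y ≡ X * Y → y < x → Y < X →
    X + Y ≡ x + y + t → ∃₂ λ e f → e * f ≡ t × Grid x y X Y e f
  grid {x} {y} {X} {Y} xy≢0 xy≡XY y<x Y<X sum
    with a , b , c , d , x≡ab , y≡cd , X≡ac , Y≡bd ← four-number x y X Y xy≢0 xy≡XY
    with e , f , a≡d+e , c≡b+f , ef≡t ← differences a b c d x≡ab y≡cd X≡ac Y≡bd y<x Y<X sum
    = e , f , ef≡t , record
      { x≡ab = x≡ab ; y≡cd = y≡cd ; X≡ac = X≡ac ; Y≡bd = Y≡bd ; a≡d+e = a≡d+e ; c≡b+f = c≡b+f }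

both-even : ∀ {x y} → 2 ∣ x * y → 2 ∣ x + y → 2 ∣ x × 2 ∣ y
both-even {x} {y} 2∣xy 2∣x+y with euclidsLemma x y prime[2] 2∣xy
... | inj₁ 2∣x = 2∣x , ∣m+n∣m⇒∣n 2∣x+y 2∣x
... | inj₂ 2∣y = ∣m+n∣m⇒∣n (subst (2 ∣_) (+-comm x y) 2∣x+y) 2∣y , 2∣y

opaque
  *2-*-*2 : ∀ x y → x * 2 * (y * 2) ≡ x * y * 4
  *2-*-*2 = solve-∀

  *2-+-*2-+2 : ∀ x y → x * 2 + y * 2 + 2 ≡ (x + y + 1) * 2
  *2-+-*2-+2 = solve-∀

double-left : ∀ {n} m k → n ≡ m * k → n * 2 ≡ m * 2 * k
double-left m k h = trans (cong (_* 2) h) (swap-right m k)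
  where
  swap-right : ∀ m k → m * k * 2 ≡ m * 2 * k
  swap-right = solve-∀

double-right : ∀ {n} m k → n ≡ m * k → n * 2 ≡ m * (k * 2)
double-right m k h = trans (cong (_* 2) h) (*-assoc m k 2)

double-difference : ∀ {m} n → m ≡ n + 1 → m * 2 ≡ n * 2 + 2
double-difference n h = trans (cong (_* 2) h) (*-distribʳ-+ 2 n 1)

-- Each row and each column meets a diagonal exactly once. Doubling both entries of one diagonal
-- thus doubles all four products, and it doubles the difference along that diagonal only.
double-grid : ∀ {x y X Y e f} → Grid x y X Y 1 1 → (e ≡ 1 × f ≡ 2) ⊎ (e ≡ 2 × f ≡ 1) →
  Grid (x * 2) (y * 2) (X * 2) (Y * 2) e f
double-grid g (inj₁ (refl , refl)) = record
  { x≡ab = double-right a b x≡ab ; y≡cd = double-left c d y≡cd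
  ; X≡ac = double-right a c X≡ac ; Y≡bd = double-left b d Y≡bd
  ; a≡d+e = a≡d+e ; c≡b+f = double-difference b c≡b+f }
  where open Grid g
double-grid g (inj₂ (refl , refl)) = record
  { x≡ab = double-left a b x≡ab ; y≡cd = double-right c d y≡cd
  ; X≡ac = double-left a c X≡ac ; Y≡bd = double-right b d Y≡bd
  ; a≡d+e = double-difference d a≡d+e ; c≡b+f = c≡b+f }
  where open Grid g

opaque
  -- Halving all four numbers leaves a grid with differences 1 and 1, and the
  -- spare factor 2 can be returned to either difference.
  even-grid : ∀ {x y X Y e f} → NonZero (x * y) → x * y ≡ X * Y → y < x → Y < X →
    X + Y ≡ x + y + 2 → 2 ∣ x * y → 2 ∣ x + y → e * f ≡ 2 → Grid x y X Y e f
  even-grid {x} {y} {X} {Y} {e} {f} xy≢0 xy≡XY y<x Y<X sum 2∣xy 2∣x+y ef≡2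
    with divides x′ refl , divides y′ refl ← both-even {x} {y} 2∣xy 2∣x+y
    with divides X′ refl , divides Y′ refl ← both-even {X} {Y} (subst (2 ∣_) xy≡XY 2∣xy)
           (subst (2 ∣_) (sym sum) (∣m∣n⇒∣m+n 2∣x+y ∣-refl))
    with e′ , f′ , e′f′≡1 , g ← grid
           (m*n≢0⇒m≢0 (x′ * y′) {{subst NonZero (*2-*-*2 x′ y′) xy≢0}})
           (*-cancelʳ-≡ (x′ * y′) (X′ * Y′) 4
             (trans (sym (*2-*-*2 x′ y′)) (trans xy≡XY (*2-*-*2 X′ Y′))))
           (*-cancelʳ-< 2 y′ x′ y<x) (*-cancelʳ-< 2 Y′ X′ Y<X)
           (*-cancelʳ-≡ (X′ + Y′) (x′ + y′ + 1) 2
             (trans (*-distribʳ-+ 2 X′ Y′) (trans sum (*2-+-*2-+2 x′ y′))))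
    with refl ← m*n≡1⇒m≡1 e′ f′ e′f′≡1 | refl ← m*n≡1⇒n≡1 e′ f′ e′f′≡1
    = double-grid g (prime-factors prime[2] ef≡2)

-- The sixteen factors

opaque
  -- Rows are split off one at a time: `split-product` writes `v` entrywise as `p` times `q`, where
  -- `p` is the row with product `x` and `q` is left for the other rows. The last row is all that
  -- remains of `v`.
  refinement-matrix : ∀ {m n} (r : Vec ℕ (suc m)) (v : Vec ℕ n) → NonZero (product v) → product r ≡ product v →
    ∃ λ (M : Vec (Vec ℕ n) (suc m)) → r ≡ Vec.map product M × v ≡ foldr₁ (zipWith _*_) M
  refinement-matrix (x Vec.∷ Vec.[]) v _ x1≡v =
    v Vec.∷ Vec.[] , cong (Vec._∷ Vec.[]) (trans (sym (*-identityʳ x)) x1≡v) , refl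
  refinement-matrix (x Vec.∷ r@(_ Vec.∷ _)) v v≢0 xr≡v
    with p , q , v≡pq , x≡p , r≡q ← split-product v x (product r) v≢0 xr≡v
    with M@(_ Vec.∷ _) , r≡M , q≡M ← refinement-matrix r q
           (subst NonZero r≡q (m*n≢0⇒n≢0 x {{subst NonZero (sym xr≡v) v≢0}})) r≡q
    = p Vec.∷ M , cong₂ Vec._∷_ x≡p r≡M , trans v≡pq (cong (zipWith _*_ p) q≡M)

opaque
  -- The eight factors of an x_k or y_k, in increasing order of n, run through the values of the
  -- three digits not belonging to k. The three splittings sort them by the lowest, middle or
  -- highest of these digits.
  split-low : ∀ p₀ p₁ p₂ p₃ p₄ p₅ p₆ p₇ → p₀ * p₁ * p₂ * p₃ * p₄ * p₅ * p₆ * p₇ ≡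
    (p₀ * p₂ * p₄ * p₆) * (p₁ * p₃ * p₅ * p₇)
  split-low = solve-∀

  split-middle : ∀ p₀ p₁ p₂ p₃ p₄ p₅ p₆ p₇ → p₀ * p₁ * p₂ * p₃ * p₄ * p₅ * p₆ * p₇ ≡
    (p₀ * p₁ * p₄ * p₅) * (p₂ * p₃ * p₆ * p₇)
  split-middle = solve-∀

  split-high : ∀ p₀ p₁ p₂ p₃ p₄ p₅ p₆ p₇ → p₀ * p₁ * p₂ * p₃ * p₄ * p₅ * p₆ * p₇ ≡
    (p₀ * p₁ * p₂ * p₃) * (p₄ * p₅ * p₆ * p₇)
  split-high = solve-∀

  row-product : ∀ a b c d → a * (b * (c * (d * 1))) ≡ a * b * c * d
  row-product = solve-∀

  column-product : ∀ a b c d → a * (b * (c * d)) ≡ a * b * c * d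
  column-product = solve-∀

  grid-product : ∀ a b c d → a * (c * (b * (d * 1))) ≡ a * b * (c * d)
  grid-product = solve-∀

-- The pairs (1,3) and (2,4) share `e` and `f`, which expresses β₁ = β₂. Only their equations are
-- recorded: the product 2 of the differences leaves a choice there, whereas the equations for the
-- other pairs can be recovered from `differences`.
record IsRefinement (x′ y′ : Vector ℕ 4) (e f : ℕ) (s : Vector ℕ 16) : Set where
  field
    x≡ : ∀ k → x′ k ≡ x s k
    y≡ : ∀ k → y′ k ≡ y s k
    E₁₃ : s₀ s * s₂ s * s₈ s * s₁₀ s ≡ s₅ s * s₇ s * s₁₃ s * s₁₅ s + e
    F₁₃ : s₁ s * s₃ s * s₉ s * s₁₁ s ≡ s₄ s * s₆ s * s₁₂ s * s₁₄ s + f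
    E₂₄ : s₀ s * s₁ s * s₄ s * s₅ s ≡ s₁₀ s * s₁₁ s * s₁₄ s * s₁₅ s + e
    F₂₄ : s₂ s * s₃ s * s₆ s * s₇ s ≡ s₈ s * s₉ s * s₁₂ s * s₁₃ s + f

-- The rows of the matrix correspond to the digits of n belonging to x₁ and x₃,
-- the columns to those belonging to x₂ and x₄.
assemble : ∀ {x′ y′ : Vector ℕ 4} {e f}
  (g : Grid (x′ (# 0)) (y′ (# 0)) (x′ (# 2)) (y′ (# 2)) e f)
  (h : Grid (x′ (# 1)) (y′ (# 1)) (x′ (# 3)) (y′ (# 3)) e f)
  (M : Vec (Vec ℕ 4) 4) →
  Grid.a g Vec.∷ Grid.c g Vec.∷ Grid.b g Vec.∷ Grid.d g Vec.∷ Vec.[] ≡ Vec.map product M →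
  Grid.a h Vec.∷ Grid.c h Vec.∷ Grid.b h Vec.∷ Grid.d h Vec.∷ Vec.[] ≡ foldr₁ (zipWith _*_) M →
  ∃ (IsRefinement x′ y′ e f)
assemble record { x≡ab = x₁≡ab ; y≡cd = y₁≡cd ; X≡ac = x₃≡ac ; Y≡bd = y₃≡bd
                ; a≡d+e = a≡d+e ; c≡b+f = c≡b+f }
         record { x≡ab = x₂≡ab ; y≡cd = y₂≡cd ; X≡ac = x₄≡ac ; Y≡bd = y₄≡bd
                ; a≡d+e = a′≡d′+e ; c≡b+f = c′≡b′+f }
         ((s0 Vec.∷ s2 Vec.∷ s8  Vec.∷ s10 Vec.∷ Vec.[]) Vec.∷
          (s1 Vec.∷ s3 Vec.∷ s9  Vec.∷ s11 Vec.∷ Vec.[]) Vec.∷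
          (s4 Vec.∷ s6 Vec.∷ s12 Vec.∷ s14 Vec.∷ Vec.[]) Vec.∷
          (s5 Vec.∷ s7 Vec.∷ s13 Vec.∷ s15 Vec.∷ Vec.[]) Vec.∷ Vec.[]) refl refl
  = s0 Vector.∷ s1 Vector.∷ s2 Vector.∷ s3 Vector.∷ s4 Vector.∷ s5 Vector.∷ s6 Vector.∷ s7 Vector.∷
    s8 Vector.∷ s9 Vector.∷ s10 Vector.∷ s11 Vector.∷ s12 Vector.∷ s13 Vector.∷ s14 Vector.∷ s15 Vector.∷ Vector.[]
  , record
    { x≡ = λ where
        Fin.zero → trans x₁≡ab (trans (cong₂ _*_ a₁₃ b₁₃)
          (sym (split-middle s0 s2 s4 s6 s8 s10 s12 s14)))
        (Fin.suc Fin.zero) → trans x₂≡ab (trans (cong₂ _*_ a₂₄ b₂₄)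
          (sym (split-high s0 s1 s4 s5 s8 s9 s12 s13)))
        (Fin.suc (Fin.suc Fin.zero)) → trans x₃≡ac (trans (cong₂ _*_ a₁₃ c₁₃)
          (sym (split-low s0 s1 s2 s3 s8 s9 s10 s11)))
        (Fin.suc (Fin.suc (Fin.suc Fin.zero))) → trans x₄≡ac (trans (cong₂ _*_ a₂₄ c₂₄)
          (sym (split-middle s0 s1 s2 s3 s4 s5 s6 s7)))
    ; y≡ = λ where
        Fin.zero → trans y₁≡cd (trans (cong₂ _*_ c₁₃ d₁₃)
          (sym (split-middle s1 s3 s5 s7 s9 s11 s13 s15)))
        (Fin.suc Fin.zero) → trans y₂≡cd (trans (cong₂ _*_ c₂₄ d₂₄)
          (sym (split-high s2 s3 s6 s7 s10 s11 s14 s15)))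
        (Fin.suc (Fin.suc Fin.zero)) → trans y₃≡bd (trans (cong₂ _*_ b₁₃ d₁₃)
          (sym (split-low s4 s5 s6 s7 s12 s13 s14 s15)))
        (Fin.suc (Fin.suc (Fin.suc Fin.zero))) → trans y₄≡bd (trans (cong₂ _*_ b₂₄ d₂₄)
          (sym (split-middle s8 s9 s10 s11 s12 s13 s14 s15)))
    ; E₁₃ = difference a₁₃ d₁₃ a≡d+e
    ; F₁₃ = difference c₁₃ b₁₃ c≡b+f
    ; E₂₄ = difference a₂₄ d₂₄ a′≡d′+e
    ; F₂₄ = difference c₂₄ b₂₄ c′≡b′+f
    }
  where
  a₁₃ = row-product s0 s2 s8 s10
  b₁₃ = row-product s4 s6 s12 s14
  c₁₃ = row-product s1 s3 s9 s11
  d₁₃ = row-product s5 s7 s13 s15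
  a₂₄ = column-product s0 s1 s4 s5
  b₂₄ = column-product s8 s9 s12 s13
  c₂₄ = column-product s2 s3 s6 s7
  d₂₄ = column-product s10 s11 s14 s15
  difference : ∀ {m m′ n n′ t} → m ≡ m′ → n ≡ n′ → m ≡ n + t → m′ ≡ n′ + t
  difference refl refl h = h

refinement : ∀ {x′ y′ : Vector ℕ 4} {e f} → NonZero (x′ (# 1) * y′ (# 1)) →
  x′ (# 0) * y′ (# 0) ≡ x′ (# 1) * y′ (# 1) →
  Grid (x′ (# 0)) (y′ (# 0)) (x′ (# 2)) (y′ (# 2)) e f →
  Grid (x′ (# 1)) (y′ (# 1)) (x′ (# 3)) (y′ (# 3)) e f →
  ∃ (IsRefinement x′ y′ e f)
refinement {x′} {y′} xy≢0 xy≡ g h =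
  let M , r , v = refinement-matrix
        (G.a Vec.∷ G.c Vec.∷ G.b Vec.∷ G.d Vec.∷ Vec.[])
        (H.a Vec.∷ H.c Vec.∷ H.b Vec.∷ H.d Vec.∷ Vec.[])
        (subst NonZero (sym column) xy≢0)
        (trans row (trans xy≡ (sym column)))
  in assemble g h M r v
  where
  module G = Grid g
  module H = Grid h
  row : product (G.a Vec.∷ G.c Vec.∷ G.b Vec.∷ G.d Vec.∷ Vec.[]) ≡ x′ (# 0) * y′ (# 0)
  row = trans (grid-product G.a G.b G.c G.d) (sym (cong₂ _*_ G.x≡ab G.y≡cd))
  column : product (H.a Vec.∷ H.c Vec.∷ H.b Vec.∷ H.d Vec.∷ Vec.[]) ≡ x′ (# 1) * y′ (# 1)
  column = trans (grid-product H.a H.b H.c H.d) (sym (cong₂ _*_ H.x≡ab H.y≡cd))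

-- Linear relations between products of two factors

-- Cramer's rule: p, q and r are 2 × 2 minors of the rows (Y, W), (X, V), (Z, U).
minors : ∀ X Y Z U V W {p q r} →
  X * U ≡ Z * V + p → Y * V ≡ X * W + q → Y * U ≡ Z * W + r →
  r * X ≡ p * Y + q * Z
minors X Y Z U V W {p} {q} {r} XU YV YU = +-cancelˡ-≡ (Z * W * X) _ _ (begin
  Z * W * X + r * X            ≡⟨ *-distribʳ-+ X (Z * W) r ⟨
  (Z * W + r) * X              ≡⟨ cong (_* X) YU ⟨
  Y * U * X                    ≡⟨ solve (X ∷ Y ∷ U ∷ []) ⟩
  Y * (X * U)                  ≡⟨ cong (Y *_) XU ⟩
  Y * (Z * V + p)              ≡⟨ solve (Y ∷ Z ∷ V ∷ p ∷ []) ⟩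
  Z * (Y * V) + p * Y          ≡⟨ cong (λ t → Z * t + p * Y) YV ⟩
  Z * (X * W + q) + p * Y      ≡⟨ solve (X ∷ Y ∷ Z ∷ W ∷ p ∷ q ∷ []) ⟩
  Z * W * X + (p * Y + q * Z)  ∎)
  where open ≡-Reasoning

-- For a triple of indices i < j < k, the variable t_{abc} stands for the product
-- of the two s_n whose digits belonging to i, j and k are a, b and c.
module Octants
  (t₀₀₀ t₀₀₁ t₀₁₀ t₀₁₁ t₁₀₀ t₁₀₁ t₁₁₀ t₁₁₁ : ℕ) {eᵢⱼ fᵢⱼ eⱼₖ fⱼₖ eᵢₖ fᵢₖ : ℕ}
  (Eᵢⱼ : t₀₀₀ * t₀₀₁ ≡ t₁₁₀ * t₁₁₁ + eᵢⱼ) (Fᵢⱼ : t₁₀₀ * t₁₀₁ ≡ t₀₁₀ * t₀₁₁ + fᵢⱼ)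
  (Eⱼₖ : t₀₀₀ * t₁₀₀ ≡ t₀₁₁ * t₁₁₁ + eⱼₖ) (Fⱼₖ : t₀₁₀ * t₁₁₀ ≡ t₀₀₁ * t₁₀₁ + fⱼₖ)
  (Eᵢₖ : t₀₀₀ * t₀₁₀ ≡ t₁₀₁ * t₁₁₁ + eᵢₖ) (Fᵢₖ : t₁₀₀ * t₁₁₀ ≡ t₀₀₁ * t₀₁₁ + fᵢₖ)
  where

  swapped : ∀ {a b c d t} → a * b ≡ c * d + t → b * a ≡ d * c + t
  swapped {a} {b} {c} {d} {t} h = trans (*-comm b a) (trans h (cong (_+ t) (*-comm c d)))

  -- Opposite octants, those with complementary digits, form four rows of length 2. Up to
  -- orientation of the rows, the six hypotheses give their 2 × 2 minors, and any three rows yield a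
  -- relation by `minors`. The names list the octant on the left and the two on the right.
  010~100+001 : fᵢₖ * t₀₁₀ ≡ fⱼₖ * t₁₀₀ + fᵢⱼ * t₀₀₁
  010~100+001 = minors t₀₁₀ t₁₀₀ t₀₀₁ t₁₁₀ t₁₀₁ t₀₁₁ Fⱼₖ Fᵢⱼ Fᵢₖ

  001~100+111 : eⱼₖ * t₀₀₁ ≡ eᵢⱼ * t₁₀₀ + fᵢₖ * t₁₁₁
  001~100+111 = minors t₀₀₁ t₁₀₀ t₁₁₁ t₀₀₀ t₁₁₀ t₀₁₁
    (swapped {t₀₀₀} {_} {t₁₁₀} Eᵢⱼ) Fᵢₖ (swapped {t₀₀₀} {_} {t₀₁₁} Eⱼₖ)

  101~000+011 : eⱼₖ * t₁₀₁ ≡ fᵢⱼ * t₀₀₀ + eᵢₖ * t₀₁₁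
  101~000+011 = minors t₁₀₁ t₀₀₀ t₀₁₁ t₁₀₀ t₀₁₀ t₁₁₁
    (swapped {t₁₀₀} {_} {t₀₁₀} Fᵢⱼ) Eᵢₖ Eⱼₖ

  101~110+011 : fᵢₖ * t₁₀₁ ≡ fᵢⱼ * t₁₁₀ + fⱼₖ * t₀₁₁
  101~110+011 = minors t₁₀₁ t₁₁₀ t₀₁₁ t₁₀₀ t₀₁₀ t₀₀₁
    (swapped {t₁₀₀} {_} {t₀₁₀} Fᵢⱼ) (swapped {t₀₁₀} {_} {t₀₀₁} Fⱼₖ)
    (swapped {t₁₀₀} {_} {t₀₀₁} Fᵢₖ)

  010~100+111 : eⱼₖ * t₀₁₀ ≡ eᵢₖ * t₁₀₀ + fᵢⱼ * t₁₁₁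
  010~100+111 = minors t₀₁₀ t₁₀₀ t₁₁₁ t₀₀₀ t₁₀₁ t₀₁₁
    (swapped {t₀₀₀} {_} {t₁₀₁} Eᵢₖ) Fᵢⱼ (swapped {t₀₀₀} {_} {t₀₁₁} Eⱼₖ)

  110~000+101 : eᵢₖ * t₁₁₀ ≡ fⱼₖ * t₀₀₀ + eᵢⱼ * t₁₀₁
  110~000+101 = minors t₁₁₀ t₀₀₀ t₁₀₁ t₀₁₀ t₀₀₁ t₁₁₁
    (swapped {t₀₁₀} {_} {t₀₀₁} Fⱼₖ) Eᵢⱼ Eᵢₖ

  001~010+111 : eᵢₖ * t₀₀₁ ≡ eᵢⱼ * t₀₁₀ + fⱼₖ * t₁₁₁
  001~010+111 = minors t₀₀₁ t₀₁₀ t₁₁₁ t₀₀₀ t₁₁₀ t₁₀₁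
    (swapped {t₀₀₀} {_} {t₁₁₀} Eᵢⱼ) Fⱼₖ (swapped {t₀₀₀} {_} {t₁₀₁} Eᵢₖ)

-- Rational relations from equations in natural numbers

-- Equality is checked by cross-multiplication of unnormalised fractions and then carried over to
-- normalised ones.
≐-intro : ∀ {q a b} → NonZero b → + (q * b) ≡ a → q ≐ a ∕ b
≐-intro {q} {a} {b@(suc b-1)} b≢0 qb≡a = record
  { equality = ℚ.fromℚᵘ-cong {mkℚᵘ (+ q) 0} {mkℚᵘ a b-1} (*≡* (begin
      + q ℤ.* + b  ≡⟨ ℤ.pos-* q b ⟨
      + (q * b)    ≡⟨ qb≡a ⟩
      a            ≡⟨ ℤ.*-identityʳ a ⟨
      a ℤ.* + 1    ∎)) }
  where open ≡-Reasoning

i≡[i+j]-j : ∀ i j → i ≡ i ℤ.+ j - j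
i≡[i+j]-j = ℤ-Solver.solve-∀

-- This is the shape of the numerator of `eq₆`, where the subtracted term is itself a difference
-- times a factor.
≐-difference′ : ∀ {q m n k l b} → NonZero b → q * b + n * l ≡ m + k * l →
  q ≐ + m - (+ n - + k) ℤ.* + l ∕ b
≐-difference′ {q} {m} {n} {k} {l} {b} b≢0 h = ≐-intro b≢0 (begin
  + (q * b)                                       ≡⟨ i≡[i+j]-j (+ (q * b)) (+ (n * l)) ⟩
  + (q * b + n * l) - + (n * l)                   ≡⟨ cong₂ (λ t → + t -_) h (ℤ.pos-* n l) ⟩
  + m ℤ.+ + (k * l) - + n ℤ.* + l                 ≡⟨ cong (λ t → + m ℤ.+ t - + n ℤ.* + l) (ℤ.pos-* k l) ⟩
  + m ℤ.+ + k ℤ.* + l - + n ℤ.* + l               ≡⟨ factor (+ m) (+ n) (+ k) (+ l) ⟩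
  + m - (+ n - + k) ℤ.* + l                       ∎)
  where
  open ≡-Reasoning
  factor : ∀ m n k l → m ℤ.+ k ℤ.* l - n ℤ.* l ≡ m - (n - k) ℤ.* l
  factor = ℤ-Solver.solve-∀

≐-difference : ∀ {q m n b} → NonZero b → q * b + n ≡ m → q ≐ + m - + n ∕ b
≐-difference {q} {m} {n} {b} b≢0 h = ≐-intro b≢0
  (trans (i≡[i+j]-j (+ (q * b)) (+ n)) (cong (λ t → + t - + n) h))

-- With β₁ = β₂ = `f`, the numbers `e` and `γ` stand for the quotients 2 / β₂ and 3 / δ. Clearing
-- denominators and moving negative terms across leaves equations between natural numbers.
relations : ∀ s e f δ γ {{_ : NonZero f}} {{_ : NonZero δ}} → NonZero e → 2 / f ≡ e → 3 / δ ≡ γ →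
  NonZero (s₂ s) → NonZero (s₇ s) →
  s₈ s * (f * e * s₇ s) + s₁ s * s₁₄ s ≡ γ * s₄ s * s₁₁ s →
  s₁₃ s * (f * e * s₂ s) ≡ s₄ s * s₁₁ s + δ * s₁ s * s₁₄ s →
  s₃ s * (2 * s₂ s * s₇ s) + 2 * s₄ s * s₁₄ s * s₁₂ s ≡ (s₁ s * s₁₄ s + γ * s₄ s * s₁₁ s) * s₉ s →
  s₆ s * (2 * s₂ s * s₇ s) + δ * s₁ s * s₁₄ s * s₁₂ s ≡ 2 * s₁ s * s₁₁ s * s₉ s + s₄ s * s₁₁ s * s₁₂ s →
  s₀ s * (f * s₂ s) + δ * s₁₂ s * s₁₄ s ≡ s₉ s * s₁₁ s →
  s₅ s * (f * s₇ s) + s₁₂ s * s₁₄ s ≡ γ * s₉ s * s₁₁ s →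
  s₁₀ s * (f * s₂ s) ≡ s₁ s * s₉ s + s₄ s * s₁₂ s →
  s₁₅ s * (f * s₇ s) + s₁ s * s₉ s ≡ s₄ s * s₁₂ s →
  Relations s f f δ
relations s e f δ γ e≢0 refl refl s₂≢0 s₇≢0 eq₈ eq₁₃ eq₃ eq₆ eq₀ eq₅ eq₁₀ eq₁₅ = record
  { eq₈  = ≐-difference fes₇≢0 eq₈
  ; eq₁₃ = ≐-intro fes₂≢0 (cong +_ eq₁₃)
  ; eq₃  = ≐-difference 2s₂s₇≢0 eq₃
  ; eq₆  = ≐-difference′ {n = δ * s₁ s * s₁₄ s} {s₄ s * s₁₁ s} {s₁₂ s} 2s₂s₇≢0 eq₆
  ; eq₀  = ≐-difference fs₂≢0 eq₀
  ; eq₅  = ≐-difference fs₇≢0 eq₅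
  ; eq₁₀ = ≐-intro fs₂≢0 (cong +_ eq₁₀)
  ; eq₁₅ = subst (s₁₅ s ≐_∕ f * s₇ s) (ℤ.+-comm (+ (s₄ s * s₁₂ s)) (ℤ.- + (s₁ s * s₉ s)))
             (≐-difference fs₇≢0 eq₁₅)
  }
  where
  instance
    _ = s₂≢0
    _ = s₇≢0
    _ = e≢0
  fs₂≢0 : NonZero (f * s₂ s)
  fs₂≢0 = m*n≢0 f (s₂ s)
  fs₇≢0 : NonZero (f * s₇ s)
  fs₇≢0 = m*n≢0 f (s₇ s)
  fe≢0 : NonZero (f * e)
  fe≢0 = m*n≢0 f e
  fes₂≢0 : NonZero (f * e * s₂ s)
  fes₂≢0 = m*n≢0 (f * e) (s₂ s) {{fe≢0}}
  fes₇≢0 : NonZero (f * e * s₇ s)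
  fes₇≢0 = m*n≢0 (f * e) (s₇ s) {{fe≢0}}
  2s₂s₇≢0 : NonZero (2 * s₂ s * s₇ s)
  2s₂s₇≢0 = m*n≢0 (2 * s₂ s) (s₇ s) {{m*n≢0 2 (s₂ s)}}

-- The eight relations as consequences of the twelve equations

-- The equations for a pair of indices involve four s_n in increasing order, with two free digits.
-- Adding a third index groups them by one of these digits: adjacent factors go together if it is
-- the higher one, alternate factors if it is the lower one.
split-adjacent : ∀ a b c d a′ b′ c′ d′ {t} → a * b * c * d ≡ a′ * b′ * c′ * d′ + t →
  (a * b) * (c * d) ≡ (a′ * b′) * (c′ * d′) + t
split-adjacent a b c d a′ b′ c′ d′ {t} h =
  trans (sym (*-assoc (a * b) c d)) (trans h (cong (_+ t) (*-assoc (a′ * b′) c′ d′)))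

split-alternate : ∀ a b c d a′ b′ c′ d′ {t} → a * b * c * d ≡ a′ * b′ * c′ * d′ + t →
  (a * c) * (b * d) ≡ (a′ * c′) * (b′ * d′) + t
split-alternate a b c d a′ b′ c′ d′ {t} h =
  trans (interchange a b c d) (trans h (cong (_+ t) (sym (interchange a′ b′ c′ d′))))
  where
  interchange : ∀ a b c d → (a * c) * (b * d) ≡ a * b * c * d
  interchange = solve-∀

nonZero-+1 : ∀ {m n} → m ≡ n + 1 → NonZero m
nonZero-+1 {n = n} m≡n+1 = subst NonZero (sym (trans m≡n+1 (+-comm n 1))) _

module Identities
  (s0 s1 s2 s3 s4 s5 s6 s7 s8 s9 s10 s11 s12 s13 s14 s15 e f δ γ : ℕ)
  (ef≡2 : e * f ≡ 2)
  (E₁₂ : s0 * s4 * s8 * s12 ≡ s3 * s7 * s11 * s15 + 1)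
  (F₁₂ : s1 * s5 * s9 * s13 ≡ s2 * s6 * s10 * s14 + 1)
  (E₂₃ : s0 * s1 * s8 * s9 ≡ s6 * s7 * s14 * s15 + 1)
  (F₂₃ : s2 * s3 * s10 * s11 ≡ s4 * s5 * s12 * s13 + 1)
  (E₃₄ : s0 * s1 * s2 * s3 ≡ s12 * s13 * s14 * s15 + 1)
  (F₃₄ : s4 * s5 * s6 * s7 ≡ s8 * s9 * s10 * s11 + 1)
  (E₁₃ : s0 * s2 * s8 * s10 ≡ s5 * s7 * s13 * s15 + e)
  (F₁₃ : s1 * s3 * s9 * s11 ≡ s4 * s6 * s12 * s14 + f)
  (E₂₄ : s0 * s1 * s4 * s5 ≡ s10 * s11 * s14 * s15 + e)
  (F₂₄ : s2 * s3 * s6 * s7 ≡ s8 * s9 * s12 * s13 + f)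
  (E₁₄ : s0 * s2 * s4 * s6 ≡ s9 * s11 * s13 * s15 + δ)
  (F₁₄ : s1 * s3 * s5 * s7 ≡ s8 * s10 * s12 * s14 + γ)
  where

  module O₁₂₃ = Octants
    (s0 * s8) (s4 * s12) (s2 * s10) (s6 * s14) (s1 * s9) (s5 * s13) (s3 * s11) (s7 * s15)
    (split-alternate s0 s4 s8 s12 s3 s7 s11 s15 E₁₂) (split-alternate s1 s5 s9 s13 s2 s6 s10 s14 F₁₂)
    (split-alternate s0 s1 s8 s9 s6 s7 s14 s15 E₂₃) (split-alternate s2 s3 s10 s11 s4 s5 s12 s13 F₂₃)
    (split-alternate s0 s2 s8 s10 s5 s7 s13 s15 E₁₃) (split-alternate s1 s3 s9 s11 s4 s6 s12 s14 F₁₃)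
  module O₁₂₄ = Octants
    (s0 * s4) (s8 * s12) (s2 * s6) (s10 * s14) (s1 * s5) (s9 * s13) (s3 * s7) (s11 * s15)
    (split-adjacent s0 s4 s8 s12 s3 s7 s11 s15 E₁₂) (split-adjacent s1 s5 s9 s13 s2 s6 s10 s14 F₁₂)
    (split-alternate s0 s1 s4 s5 s10 s11 s14 s15 E₂₄) (split-alternate s2 s3 s6 s7 s8 s9 s12 s13 F₂₄)
    (split-alternate s0 s2 s4 s6 s9 s11 s13 s15 E₁₄) (split-alternate s1 s3 s5 s7 s8 s10 s12 s14 F₁₄)
  module O₁₃₄ = Octants
    (s0 * s2) (s8 * s10) (s4 * s6) (s12 * s14) (s1 * s3) (s9 * s11) (s5 * s7) (s13 * s15)
    (split-adjacent s0 s2 s8 s10 s5 s7 s13 s15 E₁₃) (split-adjacent s1 s3 s9 s11 s4 s6 s12 s14 F₁₃)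
    (split-alternate s0 s1 s2 s3 s12 s13 s14 s15 E₃₄) (split-alternate s4 s5 s6 s7 s8 s9 s10 s11 F₃₄)
    (split-adjacent s0 s2 s4 s6 s9 s11 s13 s15 E₁₄) (split-adjacent s1 s3 s5 s7 s8 s10 s12 s14 F₁₄)
  module O₂₃₄ = Octants
    (s0 * s1) (s8 * s9) (s4 * s5) (s12 * s13) (s2 * s3) (s10 * s11) (s6 * s7) (s14 * s15)
    (split-adjacent s0 s1 s8 s9 s6 s7 s14 s15 E₂₃) (split-adjacent s2 s3 s10 s11 s4 s5 s12 s13 F₂₃)
    (split-adjacent s0 s1 s2 s3 s12 s13 s14 s15 E₃₄) (split-adjacent s4 s5 s6 s7 s8 s9 s10 s11 F₃₄)
    (split-adjacent s0 s1 s4 s5 s10 s11 s14 s15 E₂₄) (split-adjacent s2 s3 s6 s7 s8 s9 s12 s13 F₂₄)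

  -- The equations with difference 1 make their left sides positive, which keeps the denominators
  -- and the factors cancelled below from vanishing.
  s2s3s10≢0 : NonZero (s2 * s3 * s10)
  s2s3s10≢0 = m*n≢0⇒m≢0 (s2 * s3 * s10) {{nonZero-+1 F₂₃}}

  s2≢0 : NonZero s2
  s2≢0 = m*n≢0⇒m≢0 s2 {{m*n≢0⇒m≢0 (s2 * s3) {{s2s3s10≢0}}}}

  s7≢0 : NonZero s7
  s7≢0 = m*n≢0⇒n≢0 (s4 * s5 * s6) {{nonZero-+1 F₃₄}}

  s9≢0 : NonZero s9
  s9≢0 = m*n≢0⇒n≢0 (s0 * s1 * s8) {{nonZero-+1 E₂₃}}

  s10≢0 : NonZero s10
  s10≢0 = m*n≢0⇒n≢0 (s2 * s3) {{s2s3s10≢0}}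

  open ≡-Reasoning

  -- This and the next three are single octant relations, two for the triple (1,2,3) and two for
  -- (1,3,4).
  eq₁₀ : s10 * (f * s2) ≡ s1 * s9 + s4 * s12
  eq₁₀ = begin
    s10 * (f * s2)                   ≡⟨ solve (f ∷ s2 ∷ s10 ∷ []) ⟩
    f * (s2 * s10)                   ≡⟨ O₁₂₃.010~100+001 ⟩
    1 * (s1 * s9) + 1 * (s4 * s12)   ≡⟨ solve (s1 ∷ s4 ∷ s9 ∷ s12 ∷ []) ⟩
    s1 * s9 + s4 * s12               ∎

  eq₁₅ : s15 * (f * s7) + s1 * s9 ≡ s4 * s12
  eq₁₅ = begin
    s15 * (f * s7) + s1 * s9         ≡⟨ solve (f ∷ s1 ∷ s7 ∷ s9 ∷ s15 ∷ []) ⟩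
    1 * (s1 * s9) + f * (s7 * s15)   ≡⟨ O₁₂₃.001~100+111 ⟨
    1 * (s4 * s12)                   ≡⟨ *-identityˡ (s4 * s12) ⟩
    s4 * s12                         ∎

  eq₀ : s0 * (f * s2) + δ * s12 * s14 ≡ s9 * s11
  eq₀ = begin
    s0 * (f * s2) + δ * s12 * s14       ≡⟨ solve (f ∷ δ ∷ s0 ∷ s2 ∷ s12 ∷ s14 ∷ []) ⟩
    f * (s0 * s2) + δ * (s12 * s14)     ≡⟨ O₁₃₄.101~000+011 ⟨
    1 * (s9 * s11)                      ≡⟨ *-identityˡ (s9 * s11) ⟩
    s9 * s11                            ∎

  eq₅ : s5 * (f * s7) + s12 * s14 ≡ γ * s9 * s11
  eq₅ = begin
    s5 * (f * s7) + s12 * s14           ≡⟨ solve (f ∷ s5 ∷ s7 ∷ s12 ∷ s14 ∷ []) ⟩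
    f * (s5 * s7) + 1 * (s12 * s14)     ≡⟨ O₁₃₄.101~110+011 ⟨
    γ * (s9 * s11)                      ≡⟨ *-assoc γ s9 s11 ⟨
    γ * s9 * s11                        ∎

  -- The constant 2 is replaced by `e * f`, with `f` from the pair (1,3) and `e` from (2,4); here
  -- their agreement matters. One of the two copies of `s4 * s14 * s12` is expanded by `eq₁₅`. The
  -- resulting `s14 * s15` completes `e * (s2 * s3)` to `s4 * s5`, and `eq₅` finishes.
  eq₃ : s3 * (2 * s2 * s7) + 2 * s4 * s14 * s12 ≡ (s1 * s14 + γ * s4 * s11) * s9
  eq₃ = begin
    s3 * (2 * s2 * s7) + 2 * s4 * s14 * s12
      ≡⟨ cong (λ t → s3 * (t * s2 * s7) + 2 * s4 * s14 * s12) ef≡2 ⟨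
    s3 * (e * f * s2 * s7) + 2 * s4 * s14 * s12
      ≡⟨ solve (e ∷ f ∷ s2 ∷ s3 ∷ s4 ∷ s7 ∷ s12 ∷ s14 ∷ []) ⟩
    f * s7 * (e * (s2 * s3)) + s4 * s14 * s12 + s14 * (s4 * s12)
      ≡⟨ cong (λ t → f * s7 * (e * (s2 * s3)) + s4 * s14 * s12 + s14 * t) eq₁₅ ⟨
    f * s7 * (e * (s2 * s3)) + s4 * s14 * s12 + s14 * (s15 * (f * s7) + s1 * s9)
      ≡⟨ solve (e ∷ f ∷ s1 ∷ s2 ∷ s3 ∷ s4 ∷ s7 ∷ s9 ∷ s12 ∷ s14 ∷ s15 ∷ []) ⟩
    f * s7 * (e * (s2 * s3) + 1 * (s14 * s15)) + s4 * s14 * s12 + s1 * s14 * s9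
      ≡⟨ cong (λ t → f * s7 * t + s4 * s14 * s12 + s1 * s14 * s9) O₂₃₄.010~100+111 ⟨
    f * s7 * (1 * (s4 * s5)) + s4 * s14 * s12 + s1 * s14 * s9
      ≡⟨ solve (f ∷ s1 ∷ s4 ∷ s5 ∷ s7 ∷ s9 ∷ s12 ∷ s14 ∷ []) ⟩
    s4 * (s5 * (f * s7) + s12 * s14) + s1 * s14 * s9
      ≡⟨ cong (λ t → s4 * t + s1 * s14 * s9) eq₅ ⟩
    s4 * (γ * s9 * s11) + s1 * s14 * s9
      ≡⟨ solve (γ ∷ s1 ∷ s4 ∷ s9 ∷ s11 ∷ s14 ∷ []) ⟩
    (s1 * s14 + γ * s4 * s11) * s9 ∎

  -- Again 2 is `e * f`. An octant relation expands `e * (s6 * s7)` into two terms, to which `eq₀`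
  -- and `eq₁₀` apply.
  eq₆ : s6 * (2 * s2 * s7) + δ * s1 * s14 * s12 ≡ 2 * s1 * s11 * s9 + s4 * s11 * s12
  eq₆ = begin
    s6 * (2 * s2 * s7) + δ * s1 * s14 * s12
      ≡⟨ cong (λ t → s6 * (t * s2 * s7) + δ * s1 * s14 * s12) ef≡2 ⟨
    s6 * (e * f * s2 * s7) + δ * s1 * s14 * s12
      ≡⟨ solve (e ∷ f ∷ δ ∷ s1 ∷ s2 ∷ s6 ∷ s7 ∷ s12 ∷ s14 ∷ []) ⟩
    f * s2 * (e * (s6 * s7)) + δ * s1 * s14 * s12
      ≡⟨ cong (λ t → f * s2 * t + δ * s1 * s14 * s12) O₂₃₄.110~000+101 ⟩
    f * s2 * (1 * (s0 * s1) + 1 * (s10 * s11)) + δ * s1 * s14 * s12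
      ≡⟨ solve (f ∷ δ ∷ s0 ∷ s1 ∷ s2 ∷ s10 ∷ s11 ∷ s12 ∷ s14 ∷ []) ⟩
    s1 * (s0 * (f * s2) + δ * s12 * s14) + s11 * (s10 * (f * s2))
      ≡⟨ cong₂ (λ t t′ → s1 * t + s11 * t′) eq₀ eq₁₀ ⟩
    s1 * (s9 * s11) + s11 * (s1 * s9 + s4 * s12)
      ≡⟨ solve (s1 ∷ s4 ∷ s9 ∷ s11 ∷ s12 ∷ []) ⟩
    2 * s1 * s11 * s9 + s4 * s11 * s12 ∎

  -- Multiplication by `s9` produces `s8 * s9`, which occurs in an octant relation. The term
  -- `f * s7 * s14 * s15` is added on both sides so that `eq₁₅` applies to `s1 * s9`.
  eq₈ : s8 * (f * e * s7) + s1 * s14 ≡ γ * s4 * s11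
  eq₈ = *-cancelʳ-≡ _ _ s9 {{s9≢0}} (+-cancelʳ-≡ (f * s7 * s14 * s15) _ _ (begin
    (s8 * (f * e * s7) + s1 * s14) * s9 + f * s7 * s14 * s15
      ≡⟨ solve (e ∷ f ∷ s1 ∷ s7 ∷ s8 ∷ s9 ∷ s14 ∷ s15 ∷ []) ⟩
    f * s7 * (e * (s8 * s9)) + s14 * (s15 * (f * s7) + s1 * s9)
      ≡⟨ cong₂ (λ t t′ → f * s7 * t + s14 * t′) O₂₃₄.001~010+111 eq₁₅ ⟩
    f * s7 * (1 * (s4 * s5) + 1 * (s14 * s15)) + s14 * (s4 * s12)
      ≡⟨ solve (f ∷ s4 ∷ s5 ∷ s7 ∷ s12 ∷ s14 ∷ s15 ∷ []) ⟩
    s4 * (s5 * (f * s7) + s12 * s14) + f * s7 * s14 * s15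
      ≡⟨ cong (λ t → s4 * t + f * s7 * s14 * s15) eq₅ ⟩
    s4 * (γ * s9 * s11) + f * s7 * s14 * s15
      ≡⟨ solve (f ∷ γ ∷ s4 ∷ s7 ∷ s9 ∷ s11 ∷ s14 ∷ s15 ∷ []) ⟩
    γ * s4 * s11 * s9 + f * s7 * s14 * s15 ∎))

  -- After multiplication by `s10`, `eq₁₀` replaces `s10 * (f * s2)`. The octant relations for
  -- (1,2,4) and (2,3,4) used next share the term `s0 * s1 * s4`.
  eq₁₃ : s13 * (f * e * s2) ≡ s4 * s11 + δ * s1 * s14
  eq₁₃ = *-cancelʳ-≡ _ _ s10 {{s10≢0}} (begin
    s13 * (f * e * s2) * s10
      ≡⟨ solve (e ∷ f ∷ s2 ∷ s10 ∷ s13 ∷ []) ⟩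
    e * s13 * (s10 * (f * s2))
      ≡⟨ cong (e * s13 *_) eq₁₀ ⟩
    e * s13 * (s1 * s9 + s4 * s12)
      ≡⟨ solve (e ∷ s1 ∷ s4 ∷ s9 ∷ s12 ∷ s13 ∷ []) ⟩
    s1 * (e * (s9 * s13)) + s4 * (e * (s12 * s13))
      ≡⟨ cong (λ t → s1 * t + s4 * (e * (s12 * s13))) O₁₂₄.101~000+011 ⟩
    s1 * (1 * (s0 * s4) + δ * (s10 * s14)) + s4 * (e * (s12 * s13))
      ≡⟨ solve (e ∷ δ ∷ s0 ∷ s1 ∷ s4 ∷ s10 ∷ s12 ∷ s13 ∷ s14 ∷ []) ⟩
    s4 * (1 * (s0 * s1) + e * (s12 * s13)) + δ * s1 * s14 * s10
      ≡⟨ cong (λ t → s4 * t + δ * s1 * s14 * s10) O₂₃₄.101~000+011 ⟨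
    s4 * (1 * (s10 * s11)) + δ * s1 * s14 * s10
      ≡⟨ solve (δ ∷ s1 ∷ s4 ∷ s10 ∷ s11 ∷ s14 ∷ []) ⟩
    (s4 * s11 + δ * s1 * s14) * s10 ∎)

-- From a refinement to a solution

Solution : Vector ℕ 4 → Set
Solution u = ∃[ s ] ∃[ β₁ ] ∃[ β₂ ] ∃[ δ ]
  β₁ ∈ 1 ∷ 2 ∷ [] × β₂ ∈ 1 ∷ 2 ∷ [] × δ ∈ 1 ∷ 3 ∷ [] ×
  Relations s β₁ β₂ δ × (∀ k → + u k ≡ + x s k - + y s k)

difference≡ : ∀ {u x y} → x ≡ u + y → + u ≡ + x - + y
difference≡ {u} {y = y} refl = i≡[i+j]-j (+ u) (+ y)

sum-gap : ∀ {x′ y′ : Vector ℕ 4} {w} → (∀ k → x′ k + y′ k ≡ w + toℕ k) →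
  ∀ i j t → toℕ j ≡ toℕ i + t → x′ j + y′ j ≡ x′ i + y′ i + t
sum-gap {x′} {y′} {w} x+y≡w+k i j t j≡i+t = begin
  x′ j + y′ j       ≡⟨ x+y≡w+k j ⟩
  w + toℕ j         ≡⟨ cong (λ n → w + n) j≡i+t ⟩
  w + (toℕ i + t)   ≡⟨ +-assoc w (toℕ i) t ⟨
  w + toℕ i + t     ≡⟨ cong (_+ t) (x+y≡w+k i) ⟨
  x′ i + y′ i + t   ∎
  where open ≡-Reasoning

module _ {x′ y′ : Vector ℕ 4} {e f w : ℕ} {s : Vector ℕ 16} (refined : IsRefinement x′ y′ e f s)
  (y<x : ∀ k → y′ k < x′ k) (x+y : ∀ k → x′ k + y′ k ≡ w + toℕ k)
  where
  open IsRefinement refined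

  pair-differences : ∀ i j t → toℕ j ≡ toℕ i + t → ∀ {a b c d} →
    x s i ≡ a * b → y s i ≡ c * d → x s j ≡ a * c → y s j ≡ b * d →
    ∃₂ λ p q → a ≡ d + p × c ≡ b + q × p * q ≡ t
  pair-differences i j t j≡i+t {a} {b} {c} {d} xᵢ yᵢ xⱼ yⱼ =
    differences a b c d (trans (x≡ i) xᵢ) (trans (y≡ i) yᵢ) (trans (x≡ j) xⱼ) (trans (y≡ j) yⱼ)
      (y<x i) (y<x j) (sum-gap {x′} {y′} x+y i j t j≡i+t)

  -- A gap of 1 leaves no choice: two natural numbers with product 1 are both 1.
  unit-differences : ∀ i j → toℕ j ≡ toℕ i + 1 → ∀ {a b c d} →
    x s i ≡ a * b → y s i ≡ c * d → x s j ≡ a * c → y s j ≡ b * d → a ≡ d + 1 × c ≡ b + 1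
  unit-differences i j j≡i+1 {b = b} {d = d} xᵢ yᵢ xⱼ yⱼ =
    let p , q , a≡d+p , c≡b+q , pq≡1 = pair-differences i j 1 j≡i+1 xᵢ yᵢ xⱼ yⱼ
    in trans a≡d+p (cong (λ n → d + n) (m*n≡1⇒m≡1 p q pq≡1))
     , trans c≡b+q (cong (λ n → b + n) (m*n≡1⇒n≡1 p q pq≡1))

  s0 = s₀ s; s1 = s₁ s; s2 = s₂ s; s3 = s₃ s; s4 = s₄ s; s5 = s₅ s; s6 = s₆ s; s7 = s₇ s
  s8 = s₈ s; s9 = s₉ s; s10 = s₁₀ s; s11 = s₁₁ s; s12 = s₁₂ s; s13 = s₁₃ s; s14 = s₁₄ s; s15 = s₁₅ s

  -- In this and the following pairs, the factors belonging to one index are sorted by the digit of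
  -- the other.
  EF₁₂ : s0 * s4 * s8 * s12 ≡ s3 * s7 * s11 * s15 + 1 × s1 * s5 * s9 * s13 ≡ s2 * s6 * s10 * s14 + 1
  EF₁₂ = unit-differences (# 0) (# 1) refl
    (split-low s0 s2 s4 s6 s8 s10 s12 s14) (split-low s1 s3 s5 s7 s9 s11 s13 s15)
    (split-low s0 s1 s4 s5 s8 s9 s12 s13) (split-low s2 s3 s6 s7 s10 s11 s14 s15)

  EF₂₃ : s0 * s1 * s8 * s9 ≡ s6 * s7 * s14 * s15 + 1 × s2 * s3 * s10 * s11 ≡ s4 * s5 * s12 * s13 + 1
  EF₂₃ = unit-differences (# 1) (# 2) refl
    (split-middle s0 s1 s4 s5 s8 s9 s12 s13) (split-middle s2 s3 s6 s7 s10 s11 s14 s15)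
    (split-middle s0 s1 s2 s3 s8 s9 s10 s11) (split-middle s4 s5 s6 s7 s12 s13 s14 s15)

  EF₃₄ : s0 * s1 * s2 * s3 ≡ s12 * s13 * s14 * s15 + 1 × s4 * s5 * s6 * s7 ≡ s8 * s9 * s10 * s11 + 1
  EF₃₄ = unit-differences (# 2) (# 3) refl
    (split-high s0 s1 s2 s3 s8 s9 s10 s11) (split-high s4 s5 s6 s7 s12 s13 s14 s15)
    (split-high s0 s1 s2 s3 s4 s5 s6 s7) (split-high s8 s9 s10 s11 s12 s13 s14 s15)

  EF₁₄ : ∃₂ λ δ γ → s0 * s2 * s4 * s6 ≡ s9 * s11 * s13 * s15 + δ ×
                    s1 * s3 * s5 * s7 ≡ s8 * s10 * s12 * s14 + γ × δ * γ ≡ 3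
  EF₁₄ = pair-differences (# 0) (# 3) 3 refl
    (split-high s0 s2 s4 s6 s8 s10 s12 s14) (split-high s1 s3 s5 s7 s9 s11 s13 s15)
    (split-low s0 s1 s2 s3 s4 s5 s6 s7) (split-low s8 s9 s10 s11 s12 s13 s14 s15)

  module _ {δ γ}
    (E₁₄ : s0 * s2 * s4 * s6 ≡ s9 * s11 * s13 * s15 + δ)
    (F₁₄ : s1 * s3 * s5 * s7 ≡ s8 * s10 * s12 * s14 + γ)
    {{_ : NonZero f}} {{_ : NonZero δ}} (e≢0 : NonZero e)
    (2/f≡e : 2 / f ≡ e) (3/δ≡γ : 3 / δ ≡ γ) (ef≡2 : e * f ≡ 2)
    where

    refinement-relations : Relations s f f δ
    refinement-relations = relations s e f δ γ e≢0 2/f≡e 3/δ≡γ I.s2≢0 I.s7≢0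
      I.eq₈ I.eq₁₃ I.eq₃ I.eq₆ I.eq₀ I.eq₅ I.eq₁₀ I.eq₁₅
      where
      module I = Identities
        s0 s1 s2 s3 s4 s5 s6 s7 s8 s9 s10 s11 s12 s13 s14 s15 e f δ γ ef≡2
        (proj₁ EF₁₂) (proj₂ EF₁₂) (proj₁ EF₂₃) (proj₂ EF₂₃) (proj₁ EF₃₄) (proj₂ EF₃₄)
        E₁₃ F₁₃ E₂₄ F₂₄ E₁₄ F₁₄

prime[3] : Prime 3
prime[3] = toWitness {a? = prime? 3} _

-- As 2 and 3 are prime, ef = 2 and δγ = 3 leave four cases. In each one β₁ = β₂ = f, and the
-- quotients 2 / f and 3 / δ evaluate to e and γ.
refinement-solution : ∀ {u x′ y′ e f w s} → IsRefinement x′ y′ e f s →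
  (∀ k → y′ k < x′ k) → (∀ k → x′ k + y′ k ≡ w + toℕ k) → e * f ≡ 2 →
  (∀ k → x′ k ≡ u k + y′ k) → Solution u
refinement-solution {u} {x′} {y′} {s = s} refined y<x x+y ef≡2 x≡u+y
  with δ , γ , E₁₄ , F₁₄ , δγ≡3 ← EF₁₄ refined y<x x+y
  = cases (prime-factors prime[2] ef≡2) (prime-factors prime[3] δγ≡3) refined E₁₄ F₁₄
  where
  u≡x-y : ∀ k → + u k ≡ + x s k - + y s k
  u≡x-y k = difference≡ (trans (sym (IsRefinement.x≡ refined k))
              (trans (x≡u+y k) (cong (λ n → u k + n) (IsRefinement.y≡ refined k))))
  cases : ∀ {e f δ γ} → (e ≡ 1 × f ≡ 2) ⊎ (e ≡ 2 × f ≡ 1) → (δ ≡ 1 × γ ≡ 3) ⊎ (δ ≡ 3 × γ ≡ 1) →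
    IsRefinement x′ y′ e f s →
    s₀ s * s₂ s * s₄ s * s₆ s ≡ s₉ s * s₁₁ s * s₁₃ s * s₁₅ s + δ →
    s₁ s * s₃ s * s₅ s * s₇ s ≡ s₈ s * s₁₀ s * s₁₂ s * s₁₄ s + γ → Solution u
  cases (inj₁ (refl , refl)) (inj₁ (refl , refl)) r E F =
    s , 2 , 2 , 1 , there (here refl) , there (here refl) , here refl
      , refinement-relations r y<x x+y E F _ refl refl refl , u≡x-y
  cases (inj₁ (refl , refl)) (inj₂ (refl , refl)) r E F =
    s , 2 , 2 , 3 , there (here refl) , there (here refl) , there (here refl)
      , refinement-relations r y<x x+y E F _ refl refl refl , u≡x-y
  cases (inj₂ (refl , refl)) (inj₁ (refl , refl)) r E F =
    s , 1 , 1 , 1 , here refl , here refl , here refl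
      , refinement-relations r y<x x+y E F _ refl refl refl , u≡x-y
  cases (inj₂ (refl , refl)) (inj₂ (refl , refl)) r E F =
    s , 1 , 1 , 3 , here refl , here refl , there (here refl)
      , refinement-relations r y<x x+y E F _ refl refl refl , u≡x-y

-- The case of nonzero N

module _ {u x′ y′ : Vector ℕ 4} {w N : ℕ} (N≢0 : NonZero N) (2∣N : 2 ∣ N)
  (u>0 : ∀ k → 0 < u k) (x≡u+y : ∀ k → x′ k ≡ u k + y′ k) (xy≡N : ∀ k → x′ k * y′ k ≡ N)
  (x+y≡w+k : ∀ k → x′ k + y′ k ≡ w + toℕ k)
  where

  y<x : ∀ k → y′ k < x′ k
  y<x k = subst (y′ k <_) (sym (x≡u+y k)) (m<n+m (y′ k) (u>0 k))

  xy≢0 : ∀ k → NonZero (x′ k * y′ k)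
  xy≢0 k = subst NonZero (sym (xy≡N k)) N≢0

  xy≡xy : ∀ i j → x′ i * y′ i ≡ x′ j * y′ j
  xy≡xy i j = trans (xy≡N i) (sym (xy≡N j))

  grid-with-gap-2 : ∀ i j → toℕ j ≡ toℕ i + 2 →
    ∃₂ λ e f → e * f ≡ 2 × Grid (x′ i) (y′ i) (x′ j) (y′ j) e f
  grid-with-gap-2 i j j≡i+2 =
    grid (xy≢0 i) (xy≡xy i j) (y<x i) (y<x j) (sum-gap {x′} {y′} x+y≡w+k i j 2 j≡i+2)

  even-grid-with-gap-2 : ∀ {e f} i j → toℕ j ≡ toℕ i + 2 → 2 ∣ w + toℕ i → e * f ≡ 2 →
    Grid (x′ i) (y′ i) (x′ j) (y′ j) e f
  even-grid-with-gap-2 i j j≡i+2 2∣w+i =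
    even-grid (xy≢0 i) (xy≡xy i j) (y<x i) (y<x j) (sum-gap {x′} {y′} x+y≡w+k i j 2 j≡i+2)
      (subst (2 ∣_) (sym (xy≡N i)) 2∣N) (subst (2 ∣_) (sym (x+y≡w+k i)) 2∣w+i)

  -- Since N is even, x and y are even for both factorisations in the pair (1, 3)
  -- or for both in the pair (2, 4), so that this pair can follow the other.
  matching-grids : ∃₂ λ e f → e * f ≡ 2 ×
    Grid (x′ (# 0)) (y′ (# 0)) (x′ (# 2)) (y′ (# 2)) e f ×
    Grid (x′ (# 1)) (y′ (# 1)) (x′ (# 3)) (y′ (# 3)) e f
  matching-grids with even-or-odd w
  ... | inj₁ (m , w≡2m) =
    let e , f , ef≡2 , g = grid-with-gap-2 (# 1) (# 3) refl
        2∣w+0 = divides m (trans (+-identityʳ w) (trans w≡2m (*-comm 2 m)))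
    in e , f , ef≡2 , even-grid-with-gap-2 (# 0) (# 2) refl 2∣w+0 ef≡2 , g
  ... | inj₂ (m , w≡1+2m) =
    let e , f , ef≡2 , g = grid-with-gap-2 (# 0) (# 2) refl
        2∣w+1 = divides (1 + m) (trans (cong (_+ 1) w≡1+2m) (1+2*m+1 m))
    in e , f , ef≡2 , g , even-grid-with-gap-2 (# 1) (# 3) refl 2∣w+1 ef≡2
    where
    1+2*m+1 : ∀ m → 1 + 2 * m + 1 ≡ (1 + m) * 2
    1+2*m+1 = solve-∀

  positive-solution : Solution u
  positive-solution =
    let e , f , ef≡2 , g₁₃ , g₂₄ = matching-grids
        s , refined = refinement {x′} {y′} (xy≢0 (# 1)) (xy≡xy (# 0) (# 1)) g₁₃ g₂₄
    in refinement-solution {u} {x′} {y′} refined y<x x+y≡w+k ef≡2 x≡u+y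

-- The case N = 0 and the conclusion

-- All digits of 15 are 1, so s₁₅ = 0 annihilates every y_k. Each of 14, 13, 11 and 7 has a single
-- digit 0, so the corresponding s_n divides exactly one x_k and can carry its value; the other s_n
-- are 1.
trivial-solution : ∀ {u : Vector ℕ 4} w → (∀ k → u k ≡ w + toℕ k) → Solution u
trivial-solution {u} w u≡w+k = s , 2 , 2 , 1 , there (here refl) , there (here refl) , here refl
  , relations s 1 2 1 3 _ refl refl _ _ (eq₈ w) (eq₁₃ w) (eq₃ w) (eq₆ w) (eq₀ w) (eq₅ w) refl refl
  , λ k → difference≡ {u k} {x s k} {y s k}
      (trans (x≡w+k k) (sym (trans (cong₂ _+_ (u≡w+k k) (y≡0 k)) (+-identityʳ (w + toℕ k)))))
  where
  s : Vector ℕ 16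
  s = 1 Vector.∷ 1 Vector.∷ 1 Vector.∷ 1 Vector.∷ 1 Vector.∷ 1 Vector.∷ 1 Vector.∷ 3 + w Vector.∷
      1 Vector.∷ 1 Vector.∷ 1 Vector.∷ 2 + w Vector.∷ 1 Vector.∷ 1 + w Vector.∷ w Vector.∷ 0 Vector.∷ Vector.[]
  x≡w+k : ∀ k → x s k ≡ w + toℕ k
  x≡w+k Fin.zero = refl
  x≡w+k (Fin.suc Fin.zero) = trans (*-identityˡ (1 + w)) (+-comm 1 w)
  x≡w+k (Fin.suc (Fin.suc Fin.zero)) = trans (*-identityˡ (2 + w)) (+-comm 2 w)
  x≡w+k (Fin.suc (Fin.suc (Fin.suc Fin.zero))) = trans (*-identityˡ (3 + w)) (+-comm 3 w)
  y≡0 : ∀ k → y s k ≡ 0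
  y≡0 Fin.zero = *-zeroʳ (1 * (3 + w) * 1 * (2 + w) * (1 + w))
  y≡0 (Fin.suc Fin.zero) = *-zeroʳ (1 * (3 + w) * 1 * (2 + w) * w)
  y≡0 (Fin.suc (Fin.suc Fin.zero)) = *-zeroʳ (1 * (3 + w) * 1 * (1 + w) * w)
  y≡0 (Fin.suc (Fin.suc (Fin.suc Fin.zero))) = *-zeroʳ (1 * (2 + w) * 1 * (1 + w) * w)
  eq₈ : ∀ w → 1 * (2 * 1 * (3 + w)) + 1 * w ≡ 3 * 1 * (2 + w)
  eq₈ = solve-∀
  eq₁₃ : ∀ w → (1 + w) * (2 * 1 * 1) ≡ 1 * (2 + w) + 1 * 1 * w
  eq₁₃ = solve-∀
  eq₃ : ∀ w → 1 * (2 * 1 * (3 + w)) + 2 * 1 * w * 1 ≡ (1 * w + 3 * 1 * (2 + w)) * 1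
  eq₃ = solve-∀
  eq₆ : ∀ w → 1 * (2 * 1 * (3 + w)) + 1 * 1 * w * 1 ≡ 2 * 1 * (2 + w) * 1 + 1 * (2 + w) * 1
  eq₆ = solve-∀
  eq₀ : ∀ w → 1 * (2 * 1) + 1 * 1 * w ≡ 1 * (2 + w)
  eq₀ = solve-∀
  eq₅ : ∀ w → 1 * (2 * (3 + w)) + 1 * w ≡ 3 * 1 * (2 + w)
  eq₅ = solve-∀

theorem1p6 : (u : Vector ℕ 4) → IsBüchi u →
    ∃[ s ] ∃[ β₁ ] ∃[ β₂ ] ∃[ δ ]
    β₁ ∈ 1 ∷ 2 ∷ [] × β₂ ∈ 1 ∷ 2 ∷ [] × δ ∈ 1 ∷ 3 ∷ [] ×
    Relations s β₁ β₂ δ ×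
    (∀ k → + u k ≡ + x s k - + y s k)
theorem1p6 u büchi =
  let w , N , 2∣N , v = common-product büchi in cases w N 2∣N v
  where
  open IsBüchi büchi
  cases : ∀ w N → 2 ∣ N → (∀ k → ∃ λ v → w + toℕ k ≡ u k + 2 * v × (u k + v) * v ≡ N) → Solution u
  -- Since u_k is positive, (u_k + v)v = 0 forces v = 0, and the u_k are consecutive integers.
  cases w zero 2∣N v = trivial-solution w λ k → u≡w+k (positive k) (proj₂ (v k))
    where
    u≡w+k : ∀ {u v n} → 0 < u → n ≡ u + 2 * v × (u + v) * v ≡ 0 → u ≡ n
    u≡w+k {u} {v} u>0 (n≡u+2v , [u+v]v≡0) with m*n≡0⇒m≡0∨n≡0 (u + v) [u+v]v≡0
    ... | inj₁ u+v≡0 = contradiction (m+n≡0⇒m≡0 u u+v≡0) (m<n⇒n≢0 u>0)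
    ... | inj₂ refl  = sym (trans n≡u+2v (+-identityʳ u))
  -- Here y_k is v and x_k is u_k + v, so that x_k + y_k = u_k + 2v.
  cases w (suc N) 2∣N v = positive-solution {y′ = λ k → proj₁ (v k)} _ 2∣N positive
    (λ _ → refl) (λ k → proj₂ (proj₂ (v k)))
    (λ k → trans (regroup (u k) (proj₁ (v k))) (sym (proj₁ (proj₂ (v k)))))
    where
    regroup : ∀ u v → u + v + v ≡ u + 2 * v
    regroup = solve-∀
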